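{- There is an absolute constant $C>0$ such that the following holds. Let $\ell\geq 0$ be an integer, and let $G$ be a graph of maximum degree $d$ with $\operatorname{tww}(G)\geq k$, where $k>\max(4d,d^2)$. If every graph $H$ of maximum degree $d$ and order less than $|V(G)|-\ell$ has $\operatorname{tww}(H)<k$, then $|\operatorname{Aut}(G)|\leq (C(\ell+1))^{\ell}$ (i.e., $|\operatorname{Aut}(G)|\leq O(\ell)^\ell$).
   Context: All graphs are finite and simple; $\operatorname{Aut}(G)$ is the automorphism group of $G$. A trigraph is a graph whose edges are colored red or black; a graph is viewed as a trigraph with all edges black. For a partition $\mathcal{P}$ of $V(G)$, the quotient trigraph $G/\mathcal{P}$ has vertex set $\mathcal{P}$; two parts $U,W$ are joined by a black edge if every pair $u\in U,w\in W$ is a black edge, are non-adjacent if no such pair is an edge, and are joined by a red edge otherwise. A contraction sequence of an $n$-vertex trigraph $G$ is a sequence $\mathcal{P}_n,\dots,\mathcal{P}_1$ of partitions of $V(G)$ where $\mathcal{P}_n$ is discrete and each $\mathcal{P}_i$ arises from $\mathcal{P}_{i+1}$ by merging two parts; its width is the maximum red degree over all $G/\mathcal{P}_i$. The twin-width $\operatorname{tww}(G)$ is the minimum width of a contraction sequence. -}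

module Defs where

open import Data.Nat using (ℕ; zero; suc; _+_; _*_; _∸_; _^_; _≤_; _<_)
open import Data.Bool using (Bool; true; false; _∧_; not; if_then_else_)
open import Data.Fin using (Fin; zero; suc; _≟_)
open import Data.Product using (Σ; ∃; _×_; _,_)
open import Relation.Nullary using (¬_)
open import Relation.Nullary.Decidable using (⌊_⌋)
open import Relation.Binary.PropositionalEquality using (_≡_; _≢_)
open import Function.Definitions using (Injective; Surjective; Bijective)

record Graph (n : ℕ) : Set where
  field
    adj    : Fin n → Fin n → Bool
    sym    : ∀ u v → adj u v ≡ adj v u
    irrefl : ∀ v → adj v v ≡ false
open Graph public

anyF : {m : ℕ} → (Fin m → Bool) → Bool
anyF {zero}  p = false
anyF {suc m} p = if p zero then true else anyF (λ i → p (suc i))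

countF : {m : ℕ} → (Fin m → Bool) → ℕ
countF {zero}  p = 0
countF {suc m} p = (if p zero then 1 else 0) + countF (λ i → p (suc i))

degree : {n : ℕ} → Graph n → Fin n → ℕ
degree G v = countF (adj G v)

MaxDegLE : {n : ℕ} → Graph n → ℕ → Set
MaxDegLE G d = ∀ v → degree G v ≤ d

-- A partition of V(G) into m parts is a surjective labelling P : Fin n → Fin m;
-- part a is the preimage of a.  In the quotient trigraph G/P, parts a ≠ b are
-- joined by a red edge iff some pair u∈a, w∈b is an edge and some pair
-- u'∈a, w'∈b is a non-edge (i.e. neither all-black nor all-non-adjacent).
redEdge : {n m : ℕ} → Graph n → (Fin n → Fin m) → Fin m → Fin m → Bool
redEdge G P a b =
  not ⌊ a ≟ b ⌋
  ∧ anyF (λ u → anyF (λ w → ⌊ P u ≟ a ⌋ ∧ ⌊ P w ≟ b ⌋ ∧ adj G u w))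
  ∧ anyF (λ u → anyF (λ w → ⌊ P u ≟ a ⌋ ∧ ⌊ P w ≟ b ⌋ ∧ not (adj G u w)))

redDegree : {n m : ℕ} → Graph n → (Fin n → Fin m) → Fin m → ℕ
redDegree G P a = countF (redEdge G P a)

-- A contraction sequence P_n, ..., P_1: P i is the partition P_{i+1} with i+1
-- parts (only i < n is relevant).  P_n is discrete, and each P_{i+1} arises from
-- P_{i+2} by merging two parts (P i factors through P (suc i); since both are
-- surjective with i+1 resp. i+2 parts, exactly two parts get merged).
-- Width < k: every quotient G/P_{i+1} has all red degrees < k.
record ContractionSeq {n : ℕ} (G : Graph n) (k : ℕ) : Set where
  field
    P        : (i : ℕ) → Fin n → Fin (suc i)
    surj     : ∀ i → suc i ≤ n → Surjective _≡_ _≡_ (P i)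
    discrete : Injective _≡_ _≡_ (P (n ∸ 1))
    merge    : ∀ i → suc (suc i) ≤ n →
               Σ (Fin (suc (suc i)) → Fin (suc i)) λ g → ∀ v → P i v ≡ g (P (suc i) v)
    width<   : ∀ i → suc i ≤ n → ∀ a → redDegree G (P i) a < k

TwwLT : {n : ℕ} → Graph n → ℕ → Set
TwwLT G k = ContractionSeq G k

TwwGE : {n : ℕ} → Graph n → ℕ → Set
TwwGE G k = ¬ TwwLT G k

record Aut {n : ℕ} (G : Graph n) : Set where
  field
    σ     : Fin n → Fin n
    bij   : Bijective _≡_ _≡_ σ
    pres  : ∀ u v → adj G (σ u) (σ v) ≡ adj G u v
open Aut public

AutCardLE : {n : ℕ} → Graph n → ℕ → Set
AutCardLE G B = ∀ (m : ℕ) (f : Fin m → Aut G) →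
  (∀ i j → i ≢ j → ∃ λ v → σ (f i) v ≢ σ (f j) v) → m ≤ B

{-# OPTIONS --safe #-}
-- Every automorphism α of G has at most ℓ vertices outside a transversal of its cycles.  If not, the
-- graph of its orbits has order less than |V(G)| − ℓ and maximum degree at most d, so it has a
-- contraction sequence of width less than k.  A part with a black edge lies in a neighbourhood, so it
-- has total degree at most d² < k; thus even the total degrees in this sequence are less than k, and
-- it continues any contraction of G to the orbits.  Such a contraction is obtained by cutting every
-- cycle into intervals of length 2^t and doubling: a cyclic interval of length 2^(t+1) meets at most
-- four intervals of length 2^t, so the degrees stay at most 4d.
--
-- Hence every automorphism moves at most 2ℓ vertices.  A random subproduct of a family of
-- automorphisms moves each vertex in the union of their supports with probability at least 1/2, so
-- this union has at most 4ℓ vertices.  Finally an automorphism is determined by the set D of vertices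
-- outside its transversal and by its restriction to D, which leaves at most 2^(4ℓ) (4ℓ + 4)^ℓ choices.

module Submission where

open import Defs
open import Data.Bool using (Bool; true; false; _∧_; not; if_then_else_)
open import Data.Fin using (Fin; zero; suc; _≟_; toℕ; fromℕ<; punchIn; punchOut; combine; funToFin; finToFun)
open import Data.Fin.Properties using (any?; suc-injective; pigeonhole; injective⇒≤; punchIn-punchOut;
  toℕ-fromℕ<; toℕ<n; combine-injective; finToFun-funToFin; punchInᵢ≢i; punchOut-punchIn; punchOut-cong) renaming (<-irrefl to <ᶠ-irrefl)
open import Data.List using (List; []; _∷_; _++_; map; length; concatMap; tabulate)
open import Data.List.Membership.Propositional using (_∈_)
open import Data.List.Membership.Propositional.Properties using (∈-map⁺; ∈-++⁺ˡ; ∈-++⁺ʳ; ∈-tabulate⁺)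
open import Data.List.Properties using (length-map; length-++; map-++; map-∘)
open import Data.List.Relation.Unary.Any using (here; there)
open import Data.Nat using (ℕ; zero; suc; _+_; _*_; _∸_; _^_; _≤_; _<_; z≤n; s≤s; s≤s⁻¹; NonZero; _/_; _%_;
  >-nonZero)
open import Data.Nat.DivMod using (m≡m%n+[m/n]*n; m%n<n; m<n*o⇒m/o<n; m/n/o≡m/[n*o]; m<n⇒m/n≡0; /-monoˡ-≤;
  n/1≡n; /-congʳ)
open import Data.Nat.ListAction using (sum)
open import Data.Nat.ListAction.Properties using (sum-++)
open import Data.Nat.Properties using (≤-refl; ≤-trans; ≤-reflexive; +-mono-≤; +-suc; +-assoc; +-comm;
  *-distribˡ-+; module ≤-Reasoning; <-cmp; n≤1+n; ≤∧≢⇒<; <-irrefl; *-mono-≤; ≤-<-trans; <-≤-trans; <-trans;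
  <⇒≤; *-comm; m∸n+n≡m; m+[n∸m]≡n; m∸n≤m; m<n⇒0<n∸m; m≤m*n; ≮⇒≥; ≰⇒>; m^n≢0; m^n>0; +-monoˡ-<; +-monoʳ-<;
  +-monoˡ-≤; *-monoˡ-≤; m≤m+n; m≤n⇒m<n∨m≡n; +-identityʳ; _<?_; _≤?_; +-mono-<; +-cancelˡ-<; m+n≤o⇒m≤o∸n;
  *-assoc; m≤n+m; +-monoʳ-≤; *-monoʳ-≤; m*n≢0; *-cancelˡ-≤; *-zeroʳ; ^-*-assoc; +-commutativeSemigroup;
  *-identityʳ; [m*n]*[o*p]≡[m*o]*[n*p])
open import Algebra.Properties.CommutativeSemigroup +-commutativeSemigroup using (interchange)
open import Data.Product using (Σ; ∃; ∃₂; _×_; _,_; proj₁; proj₂)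
open import Data.Product.Properties using (≡-dec; ,-injectiveˡ; ,-injectiveʳ)
open import Data.Sum using (_⊎_; inj₁; inj₂)
open import Function using (_∘_; id)
open import Function.Definitions using (Injective)
open import Relation.Binary.Definitions using (tri<; tri≈; tri>)
open import Relation.Binary.PropositionalEquality using (_≡_; _≢_; refl; trans; cong; cong₂; subst;
  module ≡-Reasoning) renaming (sym to ≡-sym)
open import Relation.Nullary using (¬_; Dec; yes; no; contradiction)
open import Relation.Nullary.Decidable using (⌊_⌋; _×-dec_; map′; ¬?)
open import Relation.Unary using (Decidable)
import Data.Bool as Bool
import Data.Nat as ℕ
import Function.Construct.Composition as Composition
import Function.Construct.Identity as Identity

private variable
  A B : Set
  i j k m n : ℕ

-- Counting in finite sets

dec-true : (a? : Dec A) → A → ⌊ a? ⌋ ≡ true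
dec-true (yes _) _ = refl
dec-true (no ¬a) a = contradiction a ¬a

true-dec : (a? : Dec A) → ⌊ a? ⌋ ≡ true → A
true-dec (yes a) _ = a

not-true : (a? : Dec A) → not ⌊ a? ⌋ ≡ true → ¬ A
not-true (no ¬a) _ = ¬a

true-not : (a? : Dec A) → ¬ A → not ⌊ a? ⌋ ≡ true
true-not (yes a) ¬a = contradiction a ¬a
true-not (no _)  _  = refl

∧-true : ∀ {x y} → x ∧ y ≡ true → x ≡ true × y ≡ true
∧-true {true} y≡true = refl , y≡true

true-∧ : ∀ {x y} → x ≡ true → y ≡ true → x ∧ y ≡ true
true-∧ refl y≡true = y≡true

anyF-true : (p : Fin m → Bool) → anyF p ≡ true → ∃ λ i → p i ≡ true
anyF-true {suc m} p any with p zero in eq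
... | true  = zero , eq
... | false with anyF-true (p ∘ suc) any
...   | i , pi = suc i , pi

true-anyF : (p : Fin m → Bool) (i : Fin m) → p i ≡ true → anyF p ≡ true
true-anyF p zero    pi rewrite pi = refl
true-anyF p (suc i) pi with p zero
... | true  = refl
... | false = true-anyF (p ∘ suc) i pi

indicator : Bool → ℕ
indicator b = if b then 1 else 0

indicator-mono : ∀ x y → (x ≡ true → y ≡ true) → indicator x ≤ indicator y
indicator-mono false _ _ = z≤n
indicator-mono true  y x⇒y rewrite x⇒y refl = ≤-refl

countF-mono : (p q : Fin m → Bool) → (∀ i → p i ≡ true → q i ≡ true) → countF p ≤ countF q
countF-mono {zero}  _ _ _   = z≤n
countF-mono {suc m} p q p⇒q =
  +-mono-≤ (indicator-mono (p zero) (q zero) (p⇒q zero)) (countF-mono (p ∘ suc) (q ∘ suc) (p⇒q ∘ suc))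

countF-∨ : (p q r : Fin m → Bool) → (∀ i → p i ≡ true → q i ≡ true ⊎ r i ≡ true) →
  countF p ≤ countF q + countF r
countF-∨ {zero}  _ _ _ _ = z≤n
countF-∨ {suc m} p q r p⇒qr = begin
  indicator (p zero) + countF (p ∘ suc)
    ≤⟨ +-mono-≤ (bound (p zero) (q zero) (r zero) (p⇒qr zero))
                (countF-∨ (p ∘ suc) (q ∘ suc) (r ∘ suc) (p⇒qr ∘ suc)) ⟩
  (indicator (q zero) + indicator (r zero)) + (countF (q ∘ suc) + countF (r ∘ suc))
    ≡⟨ interchange (indicator (q zero)) (indicator (r zero)) (countF (q ∘ suc)) (countF (r ∘ suc)) ⟩
  countF q + countF r ∎
  where
  open ≤-Reasoning
  bound : ∀ x y z → (x ≡ true → y ≡ true ⊎ z ≡ true) → indicator x ≤ indicator y + indicator z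
  bound false _ _ _ = z≤n
  bound true  y z h with y | z | h refl
  ... | true  | _    | _ = s≤s z≤n
  ... | false | true | _ = ≤-refl
  ... | false | false | inj₁ ()
  ... | false | false | inj₂ ()

countF-false : (p : Fin m → Bool) → (∀ i → p i ≢ true) → countF p ≡ 0
countF-false {zero}  _ _  = refl
countF-false {suc m} p ¬p with p zero in eq
... | true  = contradiction eq (¬p zero)
... | false = countF-false (p ∘ suc) (¬p ∘ suc)

countF-true : ∀ m → countF {m} (λ _ → true) ≡ m
countF-true zero    = refl
countF-true (suc m) = cong suc (countF-true m)

countF-not : (p : Fin m → Bool) → countF p + countF (not ∘ p) ≡ m
countF-not {zero}  p = refl
countF-not {suc m} p with p zero
... | true  = cong suc (countF-not (p ∘ suc))
... | false = trans (+-suc _ _) (cong suc (countF-not (p ∘ suc)))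

countF-singleton : (x : Fin m) → countF (λ i → ⌊ i ≟ x ⌋) ≤ 1
countF-singleton {suc m} zero = s≤s (≤-reflexive (countF-false {m} _ (λ i eq → case (true-dec (suc i ≟ zero) eq))))
  where
  case : ∀ {i : Fin m} → suc i ≢ zero
  case ()
countF-singleton {suc m} (suc x) =
  ≤-trans (countF-mono {m} _ _ (λ i eq → dec-true (i ≟ x) (suc-injective (true-dec (suc i ≟ suc x) eq))))
          (countF-singleton x)

countF-cover : (p : Fin m → Bool) (xs : List (Fin m)) → (∀ i → p i ≡ true → i ∈ xs) → countF p ≤ length xs
countF-cover p []       cover = ≤-reflexive (countF-false p (λ i pi → case (cover i pi)))
  where
  case : ∀ {i : Fin _} → ¬ (i ∈ [])
  case ()
countF-cover p (x ∷ xs) cover =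
  ≤-trans (countF-∨ p (λ i → ⌊ i ≟ x ⌋) rest split)
          (+-mono-≤ (countF-singleton x) (countF-cover rest xs rest-cover))
  where
  rest : Fin _ → Bool
  rest i = p i ∧ not ⌊ i ≟ x ⌋
  split : ∀ i → p i ≡ true → ⌊ i ≟ x ⌋ ≡ true ⊎ rest i ≡ true
  split i pi with i ≟ x
  ... | yes _ = inj₁ refl
  ... | no  _ = inj₂ (true-∧ pi refl)
  rest-cover : ∀ i → rest i ≡ true → i ∈ xs
  rest-cover i ri with ∧-true {p i} ri
  ... | pi , i≢x with cover i pi
  ...   | here i≡x    = contradiction i≡x (not-true (i ≟ x) i≢x)
  ...   | there i∈xs = i∈xs

elements : (Fin m → Bool) → List (Fin m)
elements {zero}  p = []
elements {suc m} p = (if p zero then zero ∷ [] else []) ++ map suc (elements (p ∘ suc))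

length-elements : (p : Fin m → Bool) → length (elements p) ≡ countF p
length-elements {zero}  p = refl
length-elements {suc m} p with p zero
... | true  = cong suc (trans (length-map Fin.suc (elements (p ∘ suc))) (length-elements (p ∘ suc)))
... | false = trans (length-map Fin.suc (elements (p ∘ suc))) (length-elements (p ∘ suc))

∈-elements : (p : Fin m → Bool) (i : Fin m) → p i ≡ true → i ∈ elements p
∈-elements p zero    pi rewrite pi = here refl
∈-elements p (suc i) pi =
  ∈-++⁺ʳ (if p zero then zero ∷ [] else []) (∈-map⁺ suc (∈-elements (p ∘ suc) i pi))

elements-cong : (p q : Fin n → Bool) → (∀ v → p v ≡ q v) → elements p ≡ elements q
elements-cong {zero}  p q eq = refl
elements-cong {suc n} p q eq = cong₂ (λ b xs → (if b then zero ∷ [] else []) ++ map suc xs)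
  (eq zero) (elements-cong (p ∘ suc) (q ∘ suc) (eq ∘ suc))

-- The default `z` makes the function total, so that a short list can be indexed by a larger fixed
-- range.
nth : A → List A → ℕ → A
nth z []       _       = z
nth z (x ∷ xs) zero    = x
nth z (x ∷ xs) (suc i) = nth z xs i

∈-nth : (z : A) {x : A} {xs : List A} → x ∈ xs → ∃ λ i → i < length xs × nth z xs i ≡ x
∈-nth z (here refl) = 0 , s≤s z≤n , refl
∈-nth z (there x∈xs) with ∈-nth z x∈xs
... | i , i< , eq = suc i , s≤s i< , eq

length-concatMap : (f : A → List B) {c : ℕ} → ∀ xs → (∀ x → length (f x) ≤ c) →
  length (concatMap f xs) ≤ length xs * c
length-concatMap f []       _ = z≤n
length-concatMap f (x ∷ xs) h =
  ≤-trans (≤-reflexive (length-++ (f x))) (+-mono-≤ (h x) (length-concatMap f xs h))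

∈-concatMap : (f : A → List B) {x : A} {y : B} {xs : List A} → x ∈ xs → y ∈ f x → y ∈ concatMap f xs
∈-concatMap f (here refl)           y∈ = ∈-++⁺ˡ y∈
∈-concatMap f {xs = z ∷ _} (there x∈) y∈ = ∈-++⁺ʳ (f z) (∈-concatMap f x∈ y∈)

pick : {P : Fin n → Set} → Decidable P → Fin n → Fin n
pick P? z with any? P?
... | yes (v , _) = v
... | no _        = z

pick-satisfies : {P : Fin n → Set} (P? : Decidable P) (z : Fin n) {v : Fin n} → P v → P (pick P? z)
pick-satisfies P? z pv with any? P?
... | yes (_ , pw) = pw
... | no ¬p        = contradiction (_ , pv) ¬p

-- Quotients by decidable equivalence relations

record Quotient (_~_ : Fin n → Fin n → Set) : Set where
  field
    parts    : ℕ
    class    : Fin n → Fin parts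
    rep      : Fin parts → Fin n
    class-rep : ∀ a → class (rep a) ≡ a
    sound    : ∀ {u v} → class u ≡ class v → u ~ v
    complete : ∀ {u v} → u ~ v → class u ≡ class v

-- Induction on `n`: vertex `zero` joins the class of an equivalent later vertex, or opens a new
-- class if there is none.
quotient : (_~_ : Fin n → Fin n → Set) → (∀ u v → Dec (u ~ v)) →
  (∀ u → u ~ u) → (∀ {u v} → u ~ v → v ~ u) → (∀ {u v w} → u ~ v → v ~ w → u ~ w) → Quotient _~_
quotient {zero} _ _ _ _ _ = record
  { parts = 0 ; class = λ () ; rep = λ () ; class-rep = λ () ; sound = λ {} ; complete = λ {} }
quotient {suc n} _~_ _~?_ r s t with any? (λ v → zero ~? suc v)
... | yes (z , 0~z) = record
  { parts = parts ; class = class′ ; rep = suc ∘ rep ; class-rep = class-rep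
  ; sound = sound′ _ _ ; complete = complete′ _ _ }
  where
  open Quotient (quotient {n} (λ u v → suc u ~ suc v) (λ u v → suc u ~? suc v) (r ∘ suc) s t)
  class′ : Fin (suc n) → Fin parts
  class′ zero    = class z
  class′ (suc v) = class v
  sound′ : ∀ u v → class′ u ≡ class′ v → u ~ v
  sound′ zero    zero    _  = r zero
  sound′ zero    (suc v) eq = t 0~z (sound eq)
  sound′ (suc u) zero    eq = t (sound eq) (s 0~z)
  sound′ (suc u) (suc v) eq = sound eq
  complete′ : ∀ u v → u ~ v → class′ u ≡ class′ v
  complete′ zero    zero    _ = refl
  complete′ zero    (suc v) e = complete (t (s 0~z) e)
  complete′ (suc u) zero    e = complete (t e 0~z)
  complete′ (suc u) (suc v) e = complete e
... | no 0≁ = record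
  { parts = suc parts ; class = class′ ; rep = rep′ ; class-rep = class-rep′
  ; sound = sound′ _ _ ; complete = complete′ _ _ }
  where
  open Quotient (quotient {n} (λ u v → suc u ~ suc v) (λ u v → suc u ~? suc v) (r ∘ suc) s t)
  class′ : Fin (suc n) → Fin (suc parts)
  class′ zero    = zero
  class′ (suc v) = suc (class v)
  rep′ : Fin (suc parts) → Fin (suc n)
  rep′ zero    = zero
  rep′ (suc a) = suc (rep a)
  class-rep′ : ∀ a → class′ (rep′ a) ≡ a
  class-rep′ zero    = refl
  class-rep′ (suc a) = cong suc (class-rep a)
  sound′ : ∀ u v → class′ u ≡ class′ v → u ~ v
  sound′ zero    zero    _  = r zero
  sound′ (suc u) (suc v) eq = sound (suc-injective eq)
  complete′ : ∀ u v → u ~ v → class′ u ≡ class′ v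
  complete′ zero    zero    _ = refl
  complete′ zero    (suc v) e = contradiction (v , e) 0≁
  complete′ (suc u) zero    e = contradiction (u , s e) 0≁
  complete′ (suc u) (suc v) e = cong suc (complete e)

kernel-quotient : {A : Set} → (∀ (x y : A) → Dec (x ≡ y)) → (f : Fin n → A) → Quotient (λ u v → f u ≡ f v)
kernel-quotient _≟ᴬ_ f = quotient _ (λ u v → f u ≟ᴬ f v) (λ _ → refl) ≡-sym trans

-- Partial contraction sequences

Onto : (Fin n → Fin m) → Set
Onto f = ∀ a → ∃ λ v → f v ≡ a

Width< : Graph n → ℕ → (Fin n → Fin m) → Set
Width< G k Q = ∀ a → redDegree G Q a < k

redEdge-true : (G : Graph n) (P : Fin n → Fin m) (a b : Fin m) → redEdge G P a b ≡ true →
  a ≢ b × ∃₂ λ u w → P u ≡ a × P w ≡ b × adj G u w ≡ true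
redEdge-true G P a b red with ∧-true {not ⌊ a ≟ b ⌋} red
... | a≢b , rest with ∧-true rest
...   | some-edge , _ with anyF-true _ some-edge
...     | u , some-w with anyF-true _ some-w
...       | w , uw with ∧-true {⌊ P u ≟ a ⌋} uw
...         | Pu , rest′ with ∧-true {⌊ P w ≟ b ⌋} rest′
...           | Pw , edge = not-true (a ≟ b) a≢b , u , w , true-dec (P u ≟ a) Pu , true-dec (P w ≟ b) Pw , edge

true-redEdge : (G : Graph n) (P : Fin n → Fin m) {u w u′ w′ : Fin n} → P u ≢ P w →
  P u′ ≡ P u → P w′ ≡ P w → adj G u w ≡ true → adj G u′ w′ ≡ false → redEdge G P (P u) (P w) ≡ true
true-redEdge G P {u} {w} {u′} {w′} a≢b Pu′ Pw′ edge nonedge =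
  true-∧ (true-not (P u ≟ P w) a≢b)
    (true-∧ (true-anyF _ u (true-anyF _ w
              (true-∧ (dec-true (P u ≟ P u) refl) (true-∧ (dec-true (P w ≟ P w) refl) edge))))
            (true-anyF _ u′ (true-anyF _ w′
              (true-∧ (dec-true (P u′ ≟ P u) Pu′) (true-∧ (dec-true (P w′ ≟ P w) Pw′) (cong not nonedge))))))

-- A red edge requires an edge of `G` between the parts, so a list of all adjacent parts suffices;
-- the bound is in fact one on the total degree.
redDegree-cover : (G : Graph n) (P : Fin n → Fin m) (a : Fin m) (xs : List (Fin m)) →
  (∀ u w → P u ≡ a → P w ≢ a → adj G u w ≡ true → P w ∈ xs) → redDegree G P a ≤ length xs
redDegree-cover G P a xs cover = countF-cover _ xs λ b red → bound b (redEdge-true G P a b red)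
  where
  bound : ∀ b → a ≢ b × (∃₂ λ u w → P u ≡ a × P w ≡ b × adj G u w ≡ true) → b ∈ xs
  bound b (a≢b , u , w , Pu , refl , edge) = cover u w Pu (a≢b ∘ ≡-sym) edge

-- A contraction sequence that starts at the partition Q instead of the discrete one.
data Contractible (G : Graph n) (k : ℕ) : (i : ℕ) → (Fin n → Fin (suc i)) → Set where
  done : ∀ {Q} → Onto Q → Width< G k Q → Contractible G k 0 Q
  step : ∀ {Q R} → Onto Q → Width< G k Q → (g : Fin (suc (suc i)) → Fin (suc i)) →
         (∀ v → R v ≡ g (Q v)) → Contractible G k i R → Contractible G k (suc i) Q

-- The indexed form that `ContractionSeq` demands; the partitions `P j` with `j > i` are
-- unconstrained.
record PartialSeq (G : Graph n) (k i : ℕ) (Q : Fin n → Fin (suc i)) : Set where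
  field
    P      : ∀ j → Fin n → Fin (suc j)
    start  : ∀ v → P i v ≡ Q v
    onto   : ∀ j → j ≤ i → Onto (P j)
    merge  : ∀ j → j < i → Σ (Fin (suc (suc j)) → Fin (suc j)) λ g → ∀ v → P j v ≡ g (P (suc j) v)
    width< : ∀ j → j ≤ i → Width< G k (P j)

partialSeq : {G : Graph n} {Q : Fin n → Fin (suc i)} → Contractible G k i Q → PartialSeq G k i Q
partialSeq {n} {G = G} (done {Q} onto w) = record
  { P = P ; start = λ _ → refl ; onto = λ { zero z≤n → onto } ; merge = λ _ () ; width< = λ { zero z≤n → w } }
  where
  P : ∀ j → Fin n → Fin (suc j)
  P zero    = Q
  P (suc j) = λ _ → zero
partialSeq {n} {suc i} {k} {G} (step {Q = Q} ontoQ w g R≡gQ c) = record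
  { P = P ; start = start ; onto = onto ; merge = merge ; width< = width< }
  where
  module S = PartialSeq (partialSeq c)
  P : ∀ j → Fin n → Fin (suc j)
  P j with j ℕ.≟ suc i
  ... | yes refl = Q
  ... | no _     = S.P j
  start : ∀ v → P (suc i) v ≡ Q v
  start v with suc i ℕ.≟ suc i
  ... | yes refl = refl
  ... | no ¬refl = contradiction refl ¬refl
  onto : ∀ j → j ≤ suc i → Onto (P j)
  onto j j≤ with j ℕ.≟ suc i
  ... | yes refl = ontoQ
  ... | no j≢    = S.onto j (s≤s⁻¹ (≤∧≢⇒< j≤ j≢))
  merge : ∀ j → j < suc i → Σ (Fin (suc (suc j)) → Fin (suc j)) λ g → ∀ v → P j v ≡ g (P (suc j) v)
  merge j j< with j ℕ.≟ suc i | suc j ℕ.≟ suc i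
  ... | yes refl | _        = contradiction j< (<-irrefl refl)
  -- The only merge that involves the new partition; `S.start` identifies the first partition of the
  -- old sequence with its given start.
  ... | no _     | yes refl = g , λ v → trans (S.start v) (R≡gQ v)
  ... | no _     | no sj≢   = S.merge j (s≤s⁻¹ (≤∧≢⇒< j< sj≢))
  width< : ∀ j → j ≤ suc i → Width< G k (P j)
  width< j j≤ with j ℕ.≟ suc i
  ... | yes refl = w
  ... | no j≢    = S.width< j (s≤s⁻¹ (≤∧≢⇒< j≤ j≢))

contractionSeq : {G : Graph (suc n)} → Contractible G k n id → ContractionSeq G k
contractionSeq {n} c = record
  { P = S.P
  ; surj = λ i i< y → proj₁ (S.onto i (s≤s⁻¹ i<) y) , λ { refl → proj₂ (S.onto i (s≤s⁻¹ i<) y) }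
  ; discrete = λ {u} {v} eq → trans (≡-sym (S.start u)) (trans eq (S.start v))
  ; merge = λ i i< → S.merge i (s≤s⁻¹ i<)
  ; width< = λ i i< → S.width< i (s≤s⁻¹ i<) }
  where module S = PartialSeq (partialSeq c)

identify : (a b : Fin (suc (suc i))) → b ≢ a → Fin (suc (suc i)) → Fin (suc i)
identify a b b≢a x with b ≟ x
... | yes _   = punchOut b≢a
... | no b≢x  = punchOut b≢x

identify-factors : {A : Set} (h : Fin (suc (suc i)) → A) (a b : Fin (suc (suc i))) (b≢a : b ≢ a) → h a ≡ h b →
  ∀ x → h (punchIn b (identify a b b≢a x)) ≡ h x
identify-factors h a b b≢a ha≡hb x with b ≟ x
... | yes refl = trans (cong h (punchIn-punchOut b≢a)) ha≡hb
... | no b≢x   = cong h (punchIn-punchOut b≢x)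

identify-onto : (a b : Fin (suc (suc i))) (b≢a : b ≢ a) → ∀ y → ∃ λ x → identify a b b≢a x ≡ y
identify-onto a b b≢a y = punchIn b y , eq
  where
  eq : identify a b b≢a (punchIn b y) ≡ y
  eq with b ≟ punchIn b y
  ... | yes b≡ = contradiction (≡-sym b≡) (punchInᵢ≢i b y)
  ... | no b≢  = trans (punchOut-cong b refl) (punchOut-punchIn b)

Refines : {A B : Set} → (Fin n → A) → (Fin n → B) → Set
Refines Q R = ∀ {u v} → Q u ≡ Q v → R u ≡ R v

-- Since any two parts of Q lying in one part of R may be merged next, the order of the merges is irrelevant.
refine : {G : Graph n} {Q : Fin n → Fin (suc i)} {R : Fin n → Fin (suc j)} → Onto Q → Onto R →
  (h : Fin (suc i) → Fin (suc j)) → (∀ v → R v ≡ h (Q v)) →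
  (∀ {l} (Q′ : Fin n → Fin l) → Onto Q′ → Refines Q Q′ → Refines Q′ R → Width< G k Q′) →
  Contractible G k j R → Contractible G k i Q
refine {n} {i} {j} {Q = Q} {R} ontoQ ontoR h R≡hQ width c with <-cmp i j
-- `R` is a function of `Q`, so it cannot have more parts: representatives of two parts of `R` would
-- lie in one part of `Q`.
... | tri< i<j _ _ with pigeonhole (s≤s i<j) (λ a → Q (proj₁ (ontoR a)))
...   | a , b , a<b , eq = contradiction a≡b (λ a≡b → <ᶠ-irrefl a≡b a<b)
  where
  a≡b : a ≡ b
  a≡b = trans (≡-sym (trans (≡-sym (R≡hQ _)) (proj₂ (ontoR a))))
              (trans (cong h eq) (trans (≡-sym (R≡hQ _)) (proj₂ (ontoR b))))
-- With equally many parts, `Q` takes the place of `R`, and `h` is absorbed into the next merge.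
refine {Q = Q} ontoQ ontoR h R≡hQ width c | tri≈ _ refl _ with c
... | done _ _ = done ontoQ (width Q ontoQ id (λ eq → trans (R≡hQ _) (trans (cong h eq) (≡-sym (R≡hQ _)))))
... | step _ _ g R′≡gR c′ =
  step ontoQ (width Q ontoQ id (λ eq → trans (R≡hQ _) (trans (cong h eq) (≡-sym (R≡hQ _)))))
       (g ∘ h) (λ v → trans (R′≡gR v) (cong g (R≡hQ v))) c′
-- Two parts of `Q` lie in one part of `R`; merging them lowers `i`, and the result still refines
-- `R`.
refine {n} {suc i} {j} {Q = Q} {R} ontoQ ontoR h R≡hQ width c | tri> _ _ j<i with pigeonhole (s≤s j<i) h
... | a , b , a<b , ha≡hb =
  step ontoQ (width Q ontoQ id (λ eq → trans (R≡hQ _) (trans (cong h eq) (≡-sym (R≡hQ _))))) g (λ _ → refl)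
    (refine onto′ ontoR (h ∘ punchIn b) R≡h′Q′
       (λ Q″ onto″ Q′≤ → width Q″ onto″ (Q′≤ ∘ cong g)) c)
  where
  b≢a : b ≢ a
  b≢a b≡a = <ᶠ-irrefl (≡-sym b≡a) a<b
  g = identify a b b≢a
  onto′ : Onto (g ∘ Q)
  onto′ y with identify-onto a b b≢a y
  ... | x , gx≡y with ontoQ x
  ...   | v , Qv≡x = v , trans (cong g Qv≡x) gx≡y
  R≡h′Q′ : ∀ v → R v ≡ h (punchIn b (g (Q v)))
  R≡h′Q′ v = trans (R≡hQ v) (≡-sym (identify-factors h a b b≢a ha≡hb (Q v)))

-- The map `h` sends a part of `Q` to the label under `R` of a vertex chosen in it.
refine-kernel : {G : Graph n} {Q : Fin n → Fin (suc i)} {R : Fin n → Fin (suc j)} → Onto Q → Onto R → Refines Q R →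
  (∀ {l} (Q′ : Fin n → Fin l) → Onto Q′ → Refines Q Q′ → Refines Q′ R → Width< G k Q′) →
  Contractible G k j R → Contractible G k i Q
refine-kernel {R = R} ontoQ ontoR Q≤R =
  refine ontoQ ontoR (λ a → R (proj₁ (ontoQ a))) (λ v → Q≤R (≡-sym (proj₂ (ontoQ _))))

-- Edges inside a fibre are exempt, because `H` has no loops.
WeakHom : Graph n → Graph m → (Fin n → Fin m) → Set
WeakHom G H q = ∀ {u w} → q u ≢ q w → adj G u w ≡ true → adj H (q u) (q w) ≡ true

-- If a part is joined to another one by a black edge, it lies in a neighbourhood and
-- meets at most d² edges; if not, all its edges already count as red in H.
pullback-width : {G : Graph n} {H : Graph m} (q : Fin n → Fin m) → WeakHom G H q → {d : ℕ} → MaxDegLE H d → d * d < k →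
  (P : Fin m → Fin i) → Width< H k P → Width< G k (P ∘ q)
pullback-width {n} {m} {k} {G = G} {H} q hom {d} deg d²<k P w a
  with any? (λ b → (redEdge G (P ∘ q) a b Bool.≟ true) ×-dec (redEdge H P a b Bool.≟ false))
... | no none = ≤-<-trans (countF-mono _ _ red) (w a)
  where
  red : ∀ b → redEdge G (P ∘ q) a b ≡ true → redEdge H P a b ≡ true
  red b redG with redEdge H P a b in eq
  ... | true  = refl
  ... | false = contradiction (b , redG , eq) none
... | yes (b , redG , ¬redH) with redEdge-true G (P ∘ q) a b redG
...   | a≢b , u , y , refl , refl , uy = ≤-<-trans
  (≤-trans (redDegree-cover G (P ∘ q) (P (q u)) (concatMap (map P ∘ nbrs) (nbrs (q y))) cover)
    (≤-trans (length-concatMap (map P ∘ nbrs) (nbrs (q y)) (λ x → ≤-trans (≤-reflexive (length-map P (nbrs x))) (nbrs≤ x)))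
             (*-mono-≤ (nbrs≤ (q y)) ≤-refl))) d²<k
  where
  nbrs : Fin m → List (Fin m)
  nbrs x = elements (adj H x)
  nbrs≤ : ∀ x → length (nbrs x) ≤ d
  nbrs≤ x = ≤-trans (≤-reflexive (length-elements (adj H x))) (deg x)
  black : ∀ x → P x ≡ P (q u) → adj H (q y) x ≡ true
  black x Px with adj H x (q y) in eq
  ... | true  = trans (sym H (q y) x) eq
  ... | false with trans (≡-sym ¬redH)
                   (true-redEdge H P a≢b Px refl (hom (a≢b ∘ cong P) uy) eq)
  ...   | ()
  cover : ∀ v z → P (q v) ≡ P (q u) → P (q z) ≢ P (q u) → adj G v z ≡ true →
          P (q z) ∈ concatMap (map P ∘ nbrs) (nbrs (q y))
  cover v z Pv Pz vz = ∈-concatMap (map P ∘ nbrs) (∈-elements (adj H (q y)) (q v) (black (q v) Pv))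
    (∈-map⁺ P (∈-elements (adj H (q v)) (q z) (hom (λ qv≡qz → Pz (trans (cong P (≡-sym qv≡qz)) Pv)) vz)))

-- For `i = m ∸ 1` the sequence starts at the partition of `G` into the fibres of `q`, because the
-- first partition of `H` is discrete.
pullback : {G : Graph n} {H : Graph m} (q : Fin n → Fin m) → Onto q → WeakHom G H q → {d : ℕ} → MaxDegLE H d → d * d < k →
  (S : ContractionSeq H k) → ∀ i → i < m → Contractible G k i (ContractionSeq.P S i ∘ q)
pullback {n} {m} {k} {G} {H} q onto hom deg d²<k S = go
  where
  open ContractionSeq S
  onto′ : ∀ i → i < m → Onto (P i ∘ q)
  onto′ i i<m a with surj i i<m a
  ... | x , Px with onto x
  ...   | v , qv = v , Px qv
  width′ : ∀ i → i < m → Width< G k (P i ∘ q)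
  width′ i i<m = pullback-width {G = G} {H} q hom deg d²<k (P i) (width< i i<m)
  go : ∀ i → i < m → Contractible G k i (P i ∘ q)
  go zero    i<m = done (onto′ 0 i<m) (width′ 0 i<m)
  go (suc i) i<m = step (onto′ (suc i) i<m) (width′ (suc i) i<m)
    (proj₁ (merge i i<m)) (λ v → proj₂ (merge i i<m) (q v)) (go i (≤-trans (n≤1+n _) i<m))

-- Cycles of a permutation

least : {P : ℕ → Set} → Decidable P → ∀ {m} → P m → ∃ λ l → l ≤ m × P l × (∀ {j} → j < l → ¬ P j)
least P? {zero}  pm = 0 , z≤n , pm , λ ()
least {P} P? {suc m} pm with P? 0
... | yes p0 = 0 , z≤n , p0 , λ ()
... | no ¬p0 with least (P? ∘ suc) {m} pm
...   | l , l≤m , pl , min = suc l , s≤s l≤m , pl , min′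
  where
  min′ : ∀ {j} → j < suc l → ¬ P j
  min′ {zero}  _   = ¬p0
  min′ {suc j} j<l = min (s≤s⁻¹ j<l)

iterate : {A : Set} → (A → A) → ℕ → A → A
iterate f zero    x = x
iterate f (suc i) x = f (iterate f i x)

iterate-+ : {A : Set} (f : A → A) → ∀ i j x → iterate f (i + j) x ≡ iterate f i (iterate f j x)
iterate-+ f zero    j x = refl
iterate-+ f (suc i) j x = cong f (iterate-+ f i j x)

iterate-injective : {A : Set} {f : A → A} → Injective _≡_ _≡_ f → ∀ i → Injective _≡_ _≡_ (iterate f i)
iterate-injective inj zero    eq = eq
iterate-injective inj (suc i) eq = iterate-injective inj i (inj eq)

iterate-* : {A : Set} (f : A → A) {p : ℕ} {x : A} → iterate f p x ≡ x → ∀ q → iterate f (q * p) x ≡ x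
iterate-* f fp zero = refl
iterate-* f {p} {x} fp (suc q) = trans (iterate-+ f p (q * p) x) (trans (cong (iterate f p) (iterate-* f fp q)) fp)

module Orbits {n : ℕ} (f : Fin n → Fin n) (inj : Injective _≡_ _≡_ f) where

  infix 4 _~_

  _~_ : Fin n → Fin n → Set
  u ~ v = ∃ λ i → iterate f i u ≡ v

  -- Two of the first `n + 1` iterates coincide, and injectivity cancels the smaller exponent. This
  -- also bounds the period by `n`.
  returns : ∀ u → ∃ λ p → p < n × iterate f (suc p) u ≡ u
  returns u with pigeonhole ≤-refl (λ (i : Fin (suc n)) → iterate f (toℕ i) u)
  ... | i , j , i<j , eq with toℕ j ∸ toℕ i in d
  ...   | zero  = contradiction (m<n⇒0<n∸m i<j) (subst (λ z → ¬ (0 < z)) (≡-sym d) λ ())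
  ...   | suc p = p , ≤-trans (≤-reflexive (≡-sym d)) (≤-trans (m∸n≤m (toℕ j) (toℕ i)) (s≤s⁻¹ (toℕ<n j)))
    , ≡-sym (iterate-injective inj (toℕ i) (trans eq (trans (cong (λ z → iterate f z u) j≡) (iterate-+ f (toℕ i) (suc p) u))))
    where
    j≡ : toℕ j ≡ toℕ i + suc p
    j≡ = trans (≡-sym (m+[n∸m]≡n (<⇒≤ i<j))) (cong (toℕ i +_) d)

  abstract
    first-return : ∀ u → ∃ λ p → p ≤ proj₁ (returns u) × iterate f (suc p) u ≡ u × (∀ {j} → j < p → iterate f (suc j) u ≢ u)
    first-return u = least (λ p → iterate f (suc p) u ≟ u) (proj₂ (proj₂ (returns u)))

  period : Fin n → ℕ
  period u = suc (proj₁ (first-return u))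

  period≤n : ∀ u → period u ≤ n
  period≤n u = ≤-<-trans (proj₁ (proj₂ (first-return u))) (proj₁ (proj₂ (returns u)))

  iterate-period : ∀ u → iterate f (period u) u ≡ u
  iterate-period u = proj₁ (proj₂ (proj₂ (first-return u)))

  iterate-distinct : ∀ u {i j} → j < period u → i < j → iterate f i u ≢ iterate f j u
  iterate-distinct u {i} {j} j<p i<j eq with j ∸ i in d
  ... | zero  = contradiction (m<n⇒0<n∸m i<j) (subst (λ z → ¬ (0 < z)) (≡-sym d) λ ())
  ... | suc q = proj₂ (proj₂ (proj₂ (first-return u))) q<
    (≡-sym (iterate-injective inj i (trans eq (trans (cong (λ z → iterate f z u) j≡) (iterate-+ f i (suc q) u)))))
    where
    j≡ : j ≡ i + suc q
    j≡ = trans (≡-sym (m+[n∸m]≡n (<⇒≤ i<j))) (cong (i +_) d)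
    q< : suc q ≤ proj₁ (first-return u)
    q< = ≤-trans (≤-reflexive (≡-sym d)) (≤-trans (m∸n≤m j i) (s≤s⁻¹ j<p))

  iterate-unique : ∀ u {i j} → i < period u → j < period u → iterate f i u ≡ iterate f j u → i ≡ j
  iterate-unique u {i} {j} i<p j<p eq with <-cmp i j
  ... | tri< i<j _ _ = contradiction eq (iterate-distinct u j<p i<j)
  ... | tri≈ _ i≡j _ = i≡j
  ... | tri> _ _ j<i = contradiction (≡-sym eq) (iterate-distinct u i<p j<i)

  iterate-% : ∀ u i → iterate f (i % period u) u ≡ iterate f i u
  iterate-% u i = ≡-sym (trans (cong (λ z → iterate f z u) (m≡m%n+[m/n]*n i (period u)))
    (trans (iterate-+ f (i % period u) _ u)
           (cong (iterate f (i % period u)) (iterate-* f (iterate-period u) (i / period u)))))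

  ~-refl : ∀ u → u ~ u
  ~-refl u = 0 , refl

  ~-sym : ∀ {u v} → u ~ v → v ~ u
  -- Together with the `i` steps from `u` these make `i` full turns; the subtraction does not
  -- truncate, since the period is positive.
  ~-sym {u} (i , refl) = i * period u ∸ i , trans (≡-sym (iterate-+ f (i * period u ∸ i) i u))
    (trans (cong (λ z → iterate f z u) (m∸n+n≡m (m≤m*n i (period u)))) (iterate-* f (iterate-period u) i))

  ~-trans : ∀ {u v w} → u ~ v → v ~ w → u ~ w
  ~-trans {u} (i , refl) (j , refl) = j + i , iterate-+ f j i u

  _~?_ : ∀ u v → Dec (u ~ v)
  u ~? v = map′ (λ (i , eq) → toℕ i , eq)
    (λ (i , eq) → fromℕ< (m%n<n i (period u)) , trans (cong (λ z → iterate f z u) (toℕ-fromℕ< (m%n<n i (period u)))) (trans (iterate-% u i) eq))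
    (any? λ (i : Fin (period u)) → iterate f (toℕ i) u ≟ v)

  abstract
    orbits : Quotient _~_
    orbits = quotient _~_ _~?_ ~-refl ~-sym ~-trans

  open Quotient orbits public using () renaming
    (parts to orbitCount; class to orbit; rep to orbitRep; class-rep to orbit-rep; sound to orbit-sound; complete to orbit-complete)

  -- The values of `root` form the transversal of the cycles.
  root : Fin n → Fin n
  root v = orbitRep (orbit v)

  root~ : ∀ v → root v ~ v
  root~ v = orbit-sound (orbit-rep (orbit v))

  root-complete : ∀ {u v} → u ~ v → root u ≡ root v
  root-complete e = cong orbitRep (orbit-complete e)

  root-sound : ∀ {u v} → root u ≡ root v → orbit u ≡ orbit v
  root-sound {u} {v} eq = trans (≡-sym (orbit-rep (orbit u))) (trans (cong orbit eq) (orbit-rep (orbit v)))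

  nonRoot : Fin n → Bool
  nonRoot v = not ⌊ root v ≟ v ⌋

  root-unique : ∀ {u v} → u ~ v → nonRoot u ≡ false → nonRoot v ≡ false → u ≡ v
  root-unique {u} {v} e nu nv with root u ≟ u | root v ≟ v
  ... | yes ru | yes rv = trans (≡-sym ru) (trans (root-complete e) rv)

  -- Every orbit contains a root, namely its representative, so there are no more orbits than roots.
  orbitCount≤ : orbitCount + countF nonRoot ≤ n
  orbitCount≤ = ≤-trans (+-monoˡ-≤ (countF nonRoot) bound) (≤-reflexive (countF-not isRoot))
    where
    isRoot : Fin n → Bool
    isRoot v = ⌊ root v ≟ v ⌋
    covered : ∀ a → a ∈ map orbit (elements isRoot)
    covered a = subst (_∈ map orbit (elements isRoot)) (orbit-rep a) (∈-map⁺ orbit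
      (∈-elements isRoot (orbitRep a) (dec-true (_ ≟ _) (cong orbitRep (orbit-rep a)))))
    open ≤-Reasoning
    bound : orbitCount ≤ countF isRoot
    bound = begin
      orbitCount                           ≡⟨ countF-true orbitCount ⟨
      countF {orbitCount} (λ _ → true)     ≤⟨ countF-cover _ (map orbit (elements isRoot)) (λ a _ → covered a) ⟩
      length (map orbit (elements isRoot)) ≡⟨ length-map orbit (elements isRoot) ⟩
      length (elements isRoot)             ≡⟨ length-elements isRoot ⟩
      countF isRoot                        ∎

  -- A coordinate along the cycle: the number of steps from the root, reduced modulo the length to
  -- make it unique.
  position : Fin n → ℕ
  position v = proj₁ (root~ v) % period (root v)

  cycleLength : Fin n → ℕ
  cycleLength v = period (root v)

  position< : ∀ v → position v < cycleLength v
  position< v = m%n<n (proj₁ (root~ v)) (period (root v))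

  iterate-position : ∀ v → iterate f (position v) (root v) ≡ v
  iterate-position v = trans (iterate-% (root v) (proj₁ (root~ v))) (proj₂ (root~ v))

  position-unique : ∀ v {i} → i < cycleLength v → iterate f i (root v) ≡ v → position v ≡ i
  position-unique v i< eq = iterate-unique (root v) (position< v) i< (trans (iterate-position v) (≡-sym eq))

  root-iterate : ∀ v j → root (iterate f j v) ≡ root v
  root-iterate v j = ≡-sym (root-complete (j , refl))

  iterate-from-root : ∀ v j → iterate f (position v + j) (root v) ≡ iterate f j v
  iterate-from-root v j = trans (cong (λ z → iterate f z (root v)) (+-comm (position v) j))
    (trans (iterate-+ f j (position v) (root v)) (cong (iterate f j) (iterate-position v)))

  position-iterate : ∀ v j {i} → i < cycleLength v → iterate f i (root v) ≡ iterate f j v → position (iterate f j v) ≡ i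
  position-iterate v j {i} i< eq = position-unique _ (subst (λ r → i < period r) (≡-sym (root-iterate v j)) i<)
    (trans (cong (iterate f i) (root-iterate v j)) eq)

  position-nowrap : ∀ v j → position v + j < cycleLength v → position (iterate f j v) ≡ position v + j
  position-nowrap v j i< = position-iterate v j i< (iterate-from-root v j)

  position-wrap : ∀ v j t → position v + j ≡ cycleLength v + t → t < cycleLength v → position (iterate f j v) ≡ t
  position-wrap v j t eq t< = position-iterate v j t< (trans (≡-sym shift) (iterate-from-root v j))
    where
    p = cycleLength v
    shift : iterate f (position v + j) (root v) ≡ iterate f t (root v)
    shift = trans (cong (λ z → iterate f z (root v)) (trans eq (+-comm p t)))
      (trans (iterate-+ f t p (root v)) (cong (iterate f t) (iterate-period (root v))))

-- Contraction along the cycles of an automorphism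

private
  below-two : ∀ {s} q → q ≤ s → s < 2 + q → s ≡ q ⊎ s ≡ 1 + q
  below-two {s} q q≤s s< with m≤n⇒m<n∨m≡n q≤s
  ... | inj₂ q≡s = inj₁ (≡-sym q≡s)
  ... | inj₁ q<s with m≤n⇒m<n∨m≡n q<s
  ...   | inj₂ eq = inj₂ (≡-sym eq)
  ...   | inj₁ lt = contradiction (≤-<-trans lt s<) (<-irrefl refl)

  below-three : ∀ {s} q → q ≤ s → s < 3 + q → s ≡ q ⊎ s ≡ 1 + q ⊎ s ≡ 2 + q
  below-three q q≤s s< with m≤n⇒m<n∨m≡n q≤s
  ... | inj₂ q≡s = inj₁ (≡-sym q≡s)
  ... | inj₁ q<s = inj₂ (below-two (suc q) q<s s<)

-- Here t is i + j modulo m; four values are needed because the last block of length L in [0 , m) may be shorter.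
window : ∀ L .{{_ : NonZero L}} m i → i < m → ∃ λ es → length es ≡ 4 ×
  (∀ j t → j < L + L → t < m → (L + L < m → t ≡ i + j ⊎ i + j ≡ m + t) → t / L ∈ es)
window L m i i<m with L + L <? m
-- At most two blocks exist here; they are listed twice to reach length four.
... | no 2L≮m = 0 ∷ 1 ∷ 0 ∷ 1 ∷ [] , refl , λ j t _ t<m _ → low (<-≤-trans t<m (≮⇒≥ 2L≮m))
  where
  low : ∀ {t} → t < L + L → t / L ∈ 0 ∷ 1 ∷ 0 ∷ 1 ∷ []
  low {t} t< with below-two 0 z≤n (m<n*o⇒m/o<n {t} {2} (subst (λ z → t < L + z) (≡-sym (+-identityʳ L)) t<))
  ... | inj₁ eq = here eq
  ... | inj₂ eq = there (here eq)
... | yes 2L<m with m ≤? i + L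
-- At most `L` positions remain before the end, so only blocks `q` and `1 + q` occur there; after
-- the wrap `t < L + L` leaves two more.
...   | yes m≤ = q ∷ 1 + q ∷ 0 ∷ 1 ∷ [] , refl , bound
  where
  q = i / L
  i<[1+q]L : i < L + q * L
  i<[1+q]L = subst (_< L + q * L) (≡-sym (m≡m%n+[m/n]*n i L)) (+-monoˡ-< (q * L) (m%n<n i L))
  bound : ∀ j t → j < L + L → t < m → (L + L < m → t ≡ i + j ⊎ i + j ≡ m + t) → t / L ∈ q ∷ 1 + q ∷ 0 ∷ 1 ∷ []
  bound j t j< t<m h with h 2L<m
  ... | inj₁ refl with below-two q (/-monoˡ-≤ L (m≤m+n i j)) (m<n*o⇒m/o<n {t} {2 + q}
          (<-≤-trans t<m (≤-trans m≤ (≤-trans (≤-reflexive (+-comm i L)) (<⇒≤ (+-monoʳ-< L i<[1+q]L))))))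
  ...   | inj₁ eq = here eq
  ...   | inj₂ eq = there (here eq)
  bound j t j< t<m h | inj₂ eq with below-two 0 z≤n (m<n*o⇒m/o<n {t} {2} (subst (λ z → t < L + z) (≡-sym (+-identityʳ L))
          (+-cancelˡ-< m t (L + L) (subst (_< m + (L + L)) eq (+-mono-< i<m j<)))))
  ...   | inj₁ eq′ = there (there (here eq′))
  ...   | inj₂ eq′ = there (there (there (here eq′)))
-- More than `L` positions remain. Three blocks may be met before the end, but after the wrap
-- `t < L` leaves only block 0.
window L m i i<m | yes 2L<m | no m≰ = q ∷ 1 + q ∷ 2 + q ∷ 0 ∷ [] , refl , bound
  where
  q = i / L
  i<[1+q]L : i < L + q * L
  i<[1+q]L = subst (_< L + q * L) (≡-sym (m≡m%n+[m/n]*n i L)) (+-monoˡ-< (q * L) (m%n<n i L))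
  bound : ∀ j t → j < L + L → t < m → (L + L < m → t ≡ i + j ⊎ i + j ≡ m + t) → t / L ∈ q ∷ 1 + q ∷ 2 + q ∷ 0 ∷ []
  bound j t j< t<m h with h 2L<m
  ... | inj₁ refl with below-three q (/-monoˡ-≤ L (m≤m+n i j)) (m<n*o⇒m/o<n {t} {3 + q}
          (<-≤-trans (+-mono-< i<[1+q]L j<) (≤-reflexive (trans (+-comm (L + q * L) (L + L)) (+-assoc L L (L + q * L))))))
  ...   | inj₁ eq        = here eq
  ...   | inj₂ (inj₁ eq) = there (here eq)
  ...   | inj₂ (inj₂ eq) = there (there (here eq))
  bound j t j< t<m h | inj₂ eq = there (there (there (here (m<n⇒m/n≡0 (+-cancelˡ-< m t L (begin-strict
      m + t        ≡⟨ eq ⟨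
      i + j        <⟨ +-monoʳ-< i j< ⟩
      i + (L + L)  ≡⟨ +-assoc i L L ⟨
      i + L + L    <⟨ +-monoˡ-< L (≰⇒> m≰) ⟩
      m + L        ∎))))))
    where open ≤-Reasoning

module _ {n : ℕ} {G : Graph n} (α : Aut G) where
  private
    f = σ α
    inj = proj₁ (bij α)
  open Orbits f inj

  adj-iterate : ∀ j u v → adj G (iterate f j u) (iterate f j v) ≡ adj G u v
  adj-iterate zero    u v = refl
  adj-iterate (suc j) u v = trans (pres α _ _) (adj-iterate j u v)

  iterate-onto : ∀ j w → ∃ λ x → iterate f j x ≡ w
  iterate-onto zero    w = w , refl
  iterate-onto (suc j) w with proj₂ (bij α) w
  ... | w′ , fw′ with iterate-onto j w′
  ...   | x , eq = x , fw′ eq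

  -- Labels the intervals of length `L` into which a cycle is cut from its root on; the root tells
  -- the cycles apart.
  block : (L : ℕ) .{{_ : NonZero L}} → Fin n → Fin n × ℕ
  block L v = root v , position v / L

  _≟ᵇ_ : ∀ (x y : Fin n × ℕ) → Dec (x ≡ y)
  _≟ᵇ_ = ≡-dec _≟_ ℕ._≟_

  -- `window` is applied to positions on the cycle of `x`. Its block numbers are turned into
  -- vertices, so that a partition coarser than the blocks can be evaluated at them.
  blocks-met : ∀ L .{{_ : NonZero L}} x → ∃ λ cs → length cs ≡ 4 ×
    (∀ j → j < L + L → ∃ λ c → c ∈ cs × block L (iterate f j x) ≡ block L c)
  blocks-met L x with window L (cycleLength x) (position x) (position< x)
  ... | es , length≡4 , cover = map vertex es , trans (length-map vertex es) length≡4 , met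
    where
    -- A number that labels no block of this cycle yields the default `x`; `met` never relies on
    -- such an entry.
    vertex : ℕ → Fin n
    vertex e = pick (λ v → block L v ≟ᵇ (root x , e)) x
    -- As `j < L + L < cycleLength x`, at most one full turn has to be subtracted.
    track : ∀ j → j < L + L → L + L < cycleLength x →
      position (iterate f j x) ≡ position x + j ⊎ position x + j ≡ cycleLength x + position (iterate f j x)
    track j j< 2L< with position x + j <? cycleLength x
    ... | yes <m = inj₁ (position-nowrap x j <m)
    ... | no ≮m = inj₂ (subst (λ z → position x + j ≡ cycleLength x + z) (≡-sym (position-wrap x j t eq t<)) eq)
      where
      t = position x + j ∸ cycleLength x
      eq : position x + j ≡ cycleLength x + t
      eq = ≡-sym (m+[n∸m]≡n (≮⇒≥ ≮m))
      t< : t < cycleLength x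
      t< = +-cancelˡ-< (cycleLength x) t (cycleLength x)
        (subst (_< cycleLength x + cycleLength x) eq (+-mono-< (position< x) (<-trans j< 2L<)))
    met : ∀ j → j < L + L → ∃ λ c → c ∈ map vertex es × block L (iterate f j x) ≡ block L c
    met j j< = vertex e , ∈-map⁺ vertex (cover j (position y) j<
        (subst (λ r → position y < period r) (root-iterate x j) (position< y)) (track j j<)) ,
        trans label (≡-sym (pick-satisfies (λ v → block L v ≟ᵇ (root x , e)) x {y} label))
      where
      y = iterate f j x
      e = position y / L
      label : block L y ≡ (root x , e)
      label = cong (_, e) (root-iterate x j)

  -- The witness `y` is the first vertex of the doubled block of `u`.
  doubled-block : ∀ L .{{_ : NonZero L}} .{{_ : NonZero (2 * L)}} u → ∃ λ y →
    ∀ v → block (2 * L) v ≡ block (2 * L) u → ∃ λ j → j < L + L × v ≡ iterate f j y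
  doubled-block L u = iterate f (q * (2 * L)) (root u) , λ v eq →
      position v % (2 * L) , <-≤-trans (m%n<n (position v) (2 * L)) (≤-reflexive (cong (L +_) (+-identityʳ L))) , (begin
      v                                                             ≡⟨ iterate-position v ⟨
      iterate f (position v) (root v)                               ≡⟨ cong (λ z → iterate f z (root v)) (m≡m%n+[m/n]*n (position v) (2 * L)) ⟩
      iterate f (position v % (2 * L) + position v / (2 * L) * (2 * L)) (root v)
        ≡⟨ cong₂ (λ z r → iterate f (position v % (2 * L) + z * (2 * L)) r) (,-injectiveʳ eq) (,-injectiveˡ eq) ⟩
      iterate f (position v % (2 * L) + q * (2 * L)) (root u)       ≡⟨ iterate-+ f (position v % (2 * L)) (q * (2 * L)) (root u) ⟩
      iterate f (position v % (2 * L)) (iterate f (q * (2 * L)) (root u)) ∎)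
    where
    open ≡-Reasoning
    q = position u / (2 * L)

  -- A part lies in a doubled block, whose vertices are `iterate f j y` with `j < L + L`. An edge at
  -- such a vertex is the image under `iterate f j` of an edge from `y` to some `x`. So all
  -- neighbours lie on at most `d` stretches of `L + L` steps, one from each neighbour `x` of `y`. A
  -- stretch meets at most four blocks, and each block lies in one part of `Q`.
  between-blocks-width : ∀ {d k l} L .{{_ : NonZero L}} .{{_ : NonZero (2 * L)}} → MaxDegLE G d → 4 * d < k →
    (Q : Fin n → Fin l) → Onto Q → Refines (block L) Q → Refines Q (block (2 * L)) → Width< G k Q
  between-blocks-width {d} L deg 4d<k Q onto fine coarse a with onto a
  ... | u , refl with doubled-block L u
  ...   | y , inside = ≤-<-trans (≤-trans (redDegree-cover G Q (Q u) xs cover) length-xs) 4d<k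
    where
    near : Fin n → List (Fin _)
    near x = map Q (proj₁ (blocks-met L x))
    near≤4 : ∀ x → length (near x) ≤ 4
    near≤4 x = ≤-reflexive (trans (length-map Q (proj₁ (blocks-met L x))) (proj₁ (proj₂ (blocks-met L x))))
    xs = concatMap near (elements (adj G y))
    open ≤-Reasoning
    length-xs : length xs ≤ 4 * d
    length-xs = begin
      length xs                         ≤⟨ length-concatMap near (elements (adj G y)) near≤4 ⟩
      length (elements (adj G y)) * 4   ≡⟨ cong (_* 4) (length-elements (adj G y)) ⟩
      degree G y * 4                    ≤⟨ *-monoˡ-≤ 4 (deg y) ⟩
      d * 4                             ≡⟨ *-comm d 4 ⟩
      4 * d                             ∎
    cover : ∀ v w → Q v ≡ Q u → Q w ≢ Q u → adj G v w ≡ true → Q w ∈ xs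
    cover v w Qv _ vw with inside v (coarse Qv)
    ... | j , j< , refl with iterate-onto j w
    ...   | x , refl with proj₂ (proj₂ (blocks-met L x)) j j<
    ...     | c , c∈ , same = ∈-concatMap near
      (∈-elements (adj G y) x (trans (≡-sym (adj-iterate j y x)) vw))
      (subst (_∈ near x) (≡-sym (fine same)) (∈-map⁺ Q c∈))

  -- The graph of the orbits

  orbitEdge? : ∀ a b → Dec (a ≢ b × ∃₂ λ u w → orbit u ≡ a × orbit w ≡ b × adj G u w ≡ true)
  orbitEdge? a b = ¬? (a ≟ b) ×-dec any? λ u → any? λ w → (orbit u ≟ a) ×-dec (orbit w ≟ b) ×-dec (adj G u w Bool.≟ true)

  orbitGraph : Graph orbitCount
  orbitGraph = record
    { adj = λ a b → ⌊ orbitEdge? a b ⌋ ; sym = symmetric ; irrefl = irreflexive }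
    where
    flip-edge : ∀ {a b} → (a ≢ b × ∃₂ λ u w → orbit u ≡ a × orbit w ≡ b × adj G u w ≡ true) →
      b ≢ a × ∃₂ λ u w → orbit u ≡ b × orbit w ≡ a × adj G u w ≡ true
    flip-edge (a≢b , u , w , u∈ , w∈ , uw) = a≢b ∘ ≡-sym , w , u , w∈ , u∈ , trans (sym G w u) uw
    symmetric : ∀ a b → ⌊ orbitEdge? a b ⌋ ≡ ⌊ orbitEdge? b a ⌋
    symmetric a b with orbitEdge? a b | orbitEdge? b a
    ... | yes _ | yes _ = refl
    ... | no _  | no _  = refl
    ... | yes e | no ¬e = contradiction (flip-edge e) ¬e
    ... | no ¬e | yes e = contradiction (flip-edge e) ¬e
    irreflexive : ∀ a → ⌊ orbitEdge? a a ⌋ ≡ false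
    irreflexive a with orbitEdge? a a
    ... | yes (a≢a , _) = contradiction refl a≢a
    ... | no _ = refl

  orbit-weakHom : WeakHom G orbitGraph orbit
  orbit-weakHom {u} {w} u≁w uw = dec-true (orbitEdge? (orbit u) (orbit w)) (u≁w , u , w , refl , refl , uw)

  -- A power of `α` carries any edge between two orbits to one at the chosen representative, so each
  -- adjacent orbit contains a neighbour of that vertex.
  orbitGraph-degree : ∀ {d} → MaxDegLE G d → MaxDegLE orbitGraph d
  orbitGraph-degree {d} deg a = ≤-trans
    (countF-cover _ (map orbit (elements (adj G (orbitRep a)))) (λ b ab → cover (true-dec (orbitEdge? a b) ab)))
    (≤-trans (≤-reflexive (trans (length-map orbit (elements (adj G (orbitRep a)))) (length-elements (adj G (orbitRep a)))))
             (deg (orbitRep a)))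
    where
    cover : ∀ {b} → (a ≢ b × ∃₂ λ u w → orbit u ≡ a × orbit w ≡ b × adj G u w ≡ true) →
      b ∈ map orbit (elements (adj G (orbitRep a)))
    cover (_ , u , w , refl , refl , uw) with orbit-sound {u} {orbitRep (orbit u)} (≡-sym (orbit-rep (orbit u)))
    ... | j , eq = subst (_∈ _) (≡-sym (orbit-complete (j , refl)))
      (∈-map⁺ orbit (∈-elements _ (iterate f j w)
        (trans (cong (λ z → adj G z (iterate f j w)) (≡-sym eq)) (trans (adj-iterate j u w) uw))))

-- From the orbits down to single vertices

n<2^n : ∀ n → n < 2 ^ n
n<2^n zero    = s≤s z≤n
n<2^n (suc n) = begin
  2 + n         ≡⟨⟩
  1 + suc n     ≤⟨ +-mono-≤ (m^n>0 2 n) (n<2^n n) ⟩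
  2 ^ n + 2 ^ n ≡⟨ cong (2 ^ n +_) (+-identityʳ (2 ^ n)) ⟨
  2 ^ suc n     ∎
  where open ≤-Reasoning

kernel-onto : {n : ℕ} {_~_ : Fin n → Fin n → Set} (K : Quotient _~_) → Onto (Quotient.class K)
kernel-onto K a = Quotient.rep K a , Quotient.class-rep K a

module _ {n : ℕ} {G : Graph (suc n)} (α : Aut G) {d k : ℕ} (deg : MaxDegLE G d) (4d<k : 4 * d < k) where
  open Orbits (σ α) (proj₁ (bij α))

  private
    level : ℕ → Fin (suc n) → Fin (suc n) × ℕ
    level t = block α (2 ^ t) {{m^n≢0 2 t}}

    level-mono : ∀ t → Refines (level t) (level (suc t))
    level-mono t {u} {v} eq = cong₂ _,_ (,-injectiveˡ eq) (begin
      position u / (2 * 2 ^ t)   ≡⟨ halve (position u) ⟩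
      position u / 2 ^ t / 2     ≡⟨ cong (_/ 2) (,-injectiveʳ eq) ⟩
      position v / 2 ^ t / 2     ≡⟨ halve (position v) ⟨
      position v / (2 * 2 ^ t)   ∎)
      where
      open ≡-Reasoning
      instance
        2^t≢0 : NonZero (2 ^ t)
        2^t≢0 = m^n≢0 2 t
        2*2^t≢0 : NonZero (2 * 2 ^ t)
        2*2^t≢0 = m^n≢0 2 (suc t)
        2^t*2≢0 : NonZero (2 ^ t * 2)
        2^t*2≢0 = m*n≢0 (2 ^ t) 2
      halve : ∀ p → p / (2 * 2 ^ t) ≡ p / 2 ^ t / 2
      halve p = trans (/-congʳ (*-comm 2 (2 ^ t))) (≡-sym (m/n/o≡m/[n*o] p (2 ^ t) 2))

    level-zero : ∀ {u v} → level 0 u ≡ level 0 v → u ≡ v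
    level-zero {u} {v} eq = trans (≡-sym (iterate-position u))
      (trans (cong₂ (iterate (σ α)) (trans (≡-sym (n/1≡n (position u))) (trans (,-injectiveʳ eq) (n/1≡n (position v)))) (,-injectiveˡ eq))
             (iterate-position v))

    -- Once `2 ^ t` exceeds all cycle lengths, every position lies in block 0.
    level-top : ∀ t → suc n ≤ t → ∀ {u v} → root u ≡ root v → level t u ≡ level t v
    level-top t n≤t {u} {v} eq = cong₂ _,_ eq (trans (zero/ u) (≡-sym (zero/ v)))
      where
      instance
        2^t≢0 : NonZero (2 ^ t)
        2^t≢0 = m^n≢0 2 t
      zero/ : ∀ u → position u / 2 ^ t ≡ 0
      zero/ u = m<n⇒m/n≡0 (<-trans (<-≤-trans (position< u) (≤-trans (period≤n (root u)) n≤t)) (n<2^n t))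

    between : ∀ t {l} (Q : Fin (suc n) → Fin l) → Onto Q → Refines (level t) Q → Refines Q (level (suc t)) → Width< G k Q
    between t = between-blocks-width α (2 ^ t) {{m^n≢0 2 t}} {{m^n≢0 2 (suc t)}} deg 4d<k

  -- All partitions between two consecutive levels are admissible, so it remains to descend through the levels.
  descend : ∀ t {i} {R : Fin (suc n) → Fin (suc i)} → Onto R → Refines (level t) R → Refines R (level (suc t)) →
    Contractible G k i R → Contractible G k n id
  descend zero ontoR fine coarse =
    refine-kernel (λ a → a , refl) ontoR (λ { refl → refl })
      (λ Q onto _ Q≤R → between 0 Q onto (λ eq → cong Q (level-zero eq)) (λ eq → coarse (Q≤R eq)))
  descend (suc t) ontoR fine coarse c = go (kernel-quotient (_≟ᵇ_ α) (level (suc t)))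
    where
    go : Quotient (λ u v → level (suc t) u ≡ level (suc t) v) → Contractible G k n id
    -- There is a vertex, hence a part; `Contractible` needs the number of parts as a successor.
    go record { parts = zero ; class = class } with class zero
    ... | ()
    go K@(record { parts = suc p ; class = class ; sound = sound ; complete = complete }) =
      descend t (kernel-onto K) (λ eq → complete (level-mono t eq)) sound
        (refine-kernel (kernel-onto K) ontoR (λ eq → fine (sound eq))
          (λ Q onto class≤Q Q≤R → between (suc t) Q onto (λ eq → class≤Q (complete eq)) (λ eq → coarse (Q≤R eq))) c)

  lift : ∀ {m} {H : Graph m} (q : Fin (suc n) → Fin m) → Onto q → WeakHom G H q →
    Refines root q → Refines q root → MaxDegLE H d → d * d < k → ContractionSeq H k → Contractible G k n id
  lift {zero}  q _ _ _ _ _ _ _ with q zero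
  ... | ()
  lift {suc r} {H} q onto hom root≤q q≤root degH d²<k S =
    -- The start is the partition into orbits: every level refines it, and it refines level `2 + n`,
    -- where each cycle is a single block.
    descend (suc n) ontoR (λ eq → cong (P r) (root≤q (,-injectiveˡ eq)))
      (λ eq → level-top (2 + n) (≤-trans (m≤n+m (suc n) 1) ≤-refl) (q≤root (discrete eq)))
      (pullback {G = G} {H} q onto hom degH d²<k S r ≤-refl)
    where
    open ContractionSeq S
    ontoR : Onto (P r ∘ q)
    ontoR a with surj r ≤-refl a
    ... | x , Px with onto x
    ...   | v , qv = v , Px qv

  orbitGraph-contractible : d * d < k → TwwLT (orbitGraph α) k → TwwLT G k
  orbitGraph-contractible d²<k S = contractionSeq
    (lift orbit (λ a → orbitRep a , orbit-rep a) (orbit-weakHom α) (λ {u} {v} → root-sound {u} {v}) (λ eq → cong orbitRep eq)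
      (orbitGraph-degree α deg) d²<k S)

  -- The only use of the minimality of `G`: with more than `ℓ` non-roots the orbit graph is small
  -- enough for the hypothesis, and its contraction sequence would lift to `G`.
  nonRoot-bound : ∀ {ℓ} → TwwGE G k → d * d < k →
    (∀ m (H : Graph m) → MaxDegLE H d → m < suc n ∸ ℓ → TwwLT H k) → countF nonRoot ≤ ℓ
  nonRoot-bound {ℓ} tww≥k d²<k small with countF nonRoot ≤? ℓ
  ... | yes ≤ℓ = ≤ℓ
  ... | no ≰ℓ = contradiction (orbitGraph-contractible d²<k (small _ (orbitGraph α) (orbitGraph-degree α deg) order<)) tww≥k
    where
    order< : orbitCount < suc n ∸ ℓ
    order< = m+n≤o⇒m≤o∸n (suc orbitCount) (≤-trans (≤-reflexive (≡-sym (+-suc orbitCount ℓ)))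
      (≤-trans (+-monoʳ-≤ orbitCount (≰⇒> ≰ℓ)) orbitCount≤))

-- Supports of families of automorphisms

sumOver : (A → ℕ) → List A → ℕ
sumOver f xs = sum (map f xs)

sumOver-+ : (f g : A → ℕ) (xs : List A) → sumOver (λ x → f x + g x) xs ≡ sumOver f xs + sumOver g xs
sumOver-+ f g []       = refl
sumOver-+ f g (x ∷ xs) =
  trans (cong (f x + g x +_) (sumOver-+ f g xs)) (interchange (f x) (g x) (sumOver f xs) (sumOver g xs))

sumOver-mono : (f g : A → ℕ) → (∀ x → f x ≤ g x) → ∀ xs → sumOver f xs ≤ sumOver g xs
sumOver-mono f g f≤g []       = z≤n
sumOver-mono f g f≤g (x ∷ xs) = +-mono-≤ (f≤g x) (sumOver-mono f g f≤g xs)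

sumOver-const : (c : ℕ) (xs : List A) → sumOver (λ _ → c) xs ≡ length xs * c
sumOver-const c []       = refl
sumOver-const c (_ ∷ xs) = cong (c +_) (sumOver-const c xs)

sumOver-++-map : (f : A → ℕ) (h : A → A) (xs : List A) →
  sumOver f (xs ++ map h xs) ≡ sumOver f xs + sumOver (f ∘ h) xs
sumOver-++-map f h xs = trans (cong sum (map-++ f xs (map h xs)))
  (trans (sum-++ (map f xs) _) (cong (λ ys → sumOver f xs + sum ys) (≡-sym (map-∘ xs))))

-- The pairs `(x , v)` with `v` in `M x` are counted in two ways, by induction on the number of
-- vertices.
double-counting : (M : A → Fin n → Bool) (S : Fin n → Bool) (xs : List A) →
  (∀ v → S v ≡ true → length xs ≤ 2 * sumOver (λ x → indicator (M x v)) xs) →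
  length xs * countF S ≤ 2 * sumOver (λ x → countF (M x)) xs
double-counting {n = zero}  M S xs half = ≤-trans (≤-reflexive (*-zeroʳ (length xs))) z≤n
double-counting {n = suc n} M S xs half = begin
  length xs * (indicator (S zero) + countF (S ∘ suc))
    ≡⟨ *-distribˡ-+ (length xs) (indicator (S zero)) (countF (S ∘ suc)) ⟩
  length xs * indicator (S zero) + length xs * countF (S ∘ suc)
    ≤⟨ +-mono-≤ (first (S zero) (half zero)) (double-counting (λ x → M x ∘ suc) (S ∘ suc) xs (half ∘ suc)) ⟩
  2 * sumOver (λ x → indicator (M x zero)) xs + 2 * sumOver (λ x → countF (M x ∘ suc)) xs
    ≡⟨ *-distribˡ-+ 2 (sumOver (λ x → indicator (M x zero)) xs) _ ⟨
  2 * (sumOver (λ x → indicator (M x zero)) xs + sumOver (λ x → countF (M x ∘ suc)) xs)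
    ≡⟨ cong (2 *_) (sumOver-+ (λ x → indicator (M x zero)) (λ x → countF (M x ∘ suc)) xs) ⟨
  2 * sumOver (λ x → countF (M x)) xs ∎
  where
  open ≤-Reasoning
  first : ∀ b → (b ≡ true → length xs ≤ 2 * sumOver (λ x → indicator (M x zero)) xs) →
    length xs * indicator b ≤ 2 * sumOver (λ x → indicator (M x zero)) xs
  first false _ = ≤-trans (≤-reflexive (*-zeroʳ (length xs))) z≤n
  first true  h = ≤-trans (≤-reflexive (*-identityʳ (length xs))) (h refl)

idᴬ : {G : Graph n} → Aut G
idᴬ = record { σ = id ; bij = Identity.bijective _≡_ ; pres = λ _ _ → refl }

_∘ᴬ_ : {G : Graph n} → Aut G → Aut G → Aut G
α ∘ᴬ β = record
  { σ = σ α ∘ σ β ; bij = Composition.bijective _≡_ _≡_ _≡_ (bij β) (bij α)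
  ; pres = λ u v → trans (pres α _ _) (pres β u v) }

moved : {G : Graph n} → Aut G → Fin n → Bool
moved α v = not ⌊ σ α v ≟ v ⌋

-- One entry for each choice of factors, with repetitions, so that a uniform entry of the list is a
-- random subproduct.
subproducts : {G : Graph n} → List (Aut G) → List (Aut G)
subproducts []       = idᴬ ∷ []
subproducts (α ∷ αs) = subproducts αs ++ map (α ∘ᴬ_) (subproducts αs)

length-subproducts : {G : Graph n} (α : Aut G) (αs : List (Aut G)) →
  length (subproducts (α ∷ αs)) ≡ length (subproducts αs) + length (subproducts αs)
length-subproducts α αs = trans (length-++ (subproducts αs))
  (cong (length (subproducts αs) +_) (length-map (α ∘ᴬ_) (subproducts αs)))

subproducts>0 : {G : Graph n} (αs : List (Aut G)) → 0 < length (subproducts αs)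
subproducts>0 []       = s≤s z≤n
subproducts>0 (α ∷ αs) = ≤-trans (subproducts>0 αs)
  (≤-trans (m≤m+n _ (length (subproducts αs))) (≤-reflexive (≡-sym (length-subproducts α αs))))

-- Let α be the outermost factor that moves v: one of β and α ∘ β moves v, and the factors
-- applied after α fix v, so they do not change whether v is moved.
half-move : {G : Graph n} (αs : List (Aut G)) (v : Fin n) {α : Aut G} → α ∈ αs → moved α v ≡ true →
  length (subproducts αs) ≤ 2 * sumOver (λ β → indicator (moved β v)) (subproducts αs)
half-move (α ∷ αs) v α∈ mv = begin
  length (subproducts (α ∷ αs))  ≡⟨ length-subproducts α αs ⟩
  length W + length W            ≡⟨ cong (length W +_) (+-identityʳ (length W)) ⟨
  2 * length W                   ≤⟨ *-monoʳ-≤ 2 bound ⟩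
  2 * (sumOver hit W + sumOver (hit ∘ (α ∘ᴬ_)) W)  ≡⟨ cong (2 *_) (sumOver-++-map hit (α ∘ᴬ_) W) ⟨
  2 * sumOver hit (subproducts (α ∷ αs))            ∎
  where
  open ≤-Reasoning
  W = subproducts αs
  hit : Aut _ → ℕ
  hit β = indicator (moved β v)
  either : σ α v ≢ v → ∀ β → 1 ≤ hit β + hit (α ∘ᴬ β)
  either αv≢v β with σ β v ≟ v
  ... | no _ = s≤s z≤n
  ... | yes βv≡v with σ α (σ β v) ≟ v
  ...   | no _    = s≤s z≤n
  ...   | yes αβv = contradiction (trans (cong (σ α) (≡-sym βv≡v)) αβv) αv≢v
  same : σ α v ≡ v → ∀ β → hit β ≤ hit (α ∘ᴬ β)
  same αv≡v β = indicator-mono (moved β v) (moved (α ∘ᴬ β) v) λ mβ → true-not (σ α (σ β v) ≟ v)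
    λ αβv → not-true (σ β v ≟ v) mβ (proj₁ (bij α) (trans αβv (≡-sym αv≡v)))
  bound : length W ≤ sumOver hit W + sumOver (hit ∘ (α ∘ᴬ_)) W
  bound with σ α v ≟ v
  ... | no αv≢v = begin
    length W                                    ≡⟨ *-identityʳ (length W) ⟨
    length W * 1                                ≡⟨ sumOver-const 1 W ⟨
    sumOver (λ _ → 1) W                         ≤⟨ sumOver-mono _ _ (either αv≢v) W ⟩
    sumOver (λ β → hit β + hit (α ∘ᴬ β)) W      ≡⟨ sumOver-+ hit (hit ∘ (α ∘ᴬ_)) W ⟩
    sumOver hit W + sumOver (hit ∘ (α ∘ᴬ_)) W   ∎
  ... | yes αv≡v = begin
    length W                                    ≤⟨ half-move αs v (later α∈) mv ⟩
    sumOver hit W + (sumOver hit W + 0)         ≡⟨ cong (sumOver hit W +_) (+-identityʳ (sumOver hit W)) ⟩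
    sumOver hit W + sumOver hit W               ≤⟨ +-monoʳ-≤ (sumOver hit W) (sumOver-mono _ _ (same αv≡v) W) ⟩
    sumOver hit W + sumOver (hit ∘ (α ∘ᴬ_)) W   ∎
    where
    later : _ ∈ α ∷ αs → _ ∈ αs
    later (here refl) = contradiction αv≡v (not-true (σ α v ≟ v) mv)
    later (there α∈)  = α∈

-- The average number of vertices moved by a subproduct is at least half of `countF S`, by
-- `half-move`, and at most `s`. The bound `s` is asked of all automorphisms, since subproducts may
-- lie outside `αs`.
support-bound : {G : Graph n} (αs : List (Aut G)) (S : Fin n → Bool) →
  (∀ v → S v ≡ true → ∃ λ α → α ∈ αs × moved α v ≡ true) →
  ∀ s → (∀ (α : Aut G) → countF (moved α) ≤ s) → countF S ≤ 2 * s
support-bound αs S covered s moved≤ = *-cancelˡ-≤ (length W) {{>-nonZero (subproducts>0 αs)}} (begin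
  length W * countF S                    ≤⟨ double-counting moved S W (λ v Sv → let _ , α∈ , mv = covered v Sv in half-move αs v α∈ mv) ⟩
  2 * sumOver (λ α → countF (moved α)) W ≤⟨ *-monoʳ-≤ 2 (sumOver-mono _ _ moved≤ W) ⟩
  2 * sumOver (λ _ → s) W                ≡⟨ cong (2 *_) (sumOver-const s W) ⟩
  2 * (length W * s)                     ≡⟨ *-assoc 2 (length W) s ⟨
  2 * length W * s                       ≡⟨ cong (_* s) (*-comm 2 (length W)) ⟩
  length W * 2 * s                       ≡⟨ *-assoc (length W) 2 s ⟩
  length W * (2 * s)                     ∎)
  where
  open ≤-Reasoning
  W = subproducts αs

-- Non-roots and moved vertices

nonRoots : {G : Graph n} → Aut G → Fin n → Bool
nonRoots α = Orbits.nonRoot (σ α) (proj₁ (bij α))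

module _ {G : Graph n} (α : Aut G) where
  open Orbits (σ α) (proj₁ (bij α))

  -- A cycle has only one root, so of a moved vertex and its image at least one is a non-root.
  moved-bound : countF (moved α) ≤ countF nonRoot + countF nonRoot
  moved-bound = ≤-trans (countF-∨ (moved α) nonRoot (nonRoot ∘ σ α) split) (+-monoʳ-≤ (countF nonRoot) preimage)
    where
    split : ∀ v → moved α v ≡ true → nonRoot v ≡ true ⊎ nonRoot (σ α v) ≡ true
    split v mv with nonRoot v in eq | nonRoot (σ α v) in eq′
    ... | true  | _     = inj₁ refl
    ... | false | true  = inj₂ refl
    ... | false | false = contradiction (≡-sym (root-unique (1 , refl) eq eq′)) (not-true (σ α v ≟ v) mv)
    inverse : Fin n → Fin n
    inverse w = proj₁ (proj₂ (bij α) w)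
    inverse-σ : ∀ v → inverse (σ α v) ≡ v
    inverse-σ v = proj₁ (bij α) (proj₂ (proj₂ (bij α) (σ α v)) refl)
    preimage : countF (nonRoot ∘ σ α) ≤ countF nonRoot
    preimage = ≤-trans
      (countF-cover _ (map inverse (elements nonRoot))
        (λ v nr → subst (_∈ _) (inverse-σ v) (∈-map⁺ inverse (∈-elements nonRoot (σ α v) nr))))
      (≤-reflexive (trans (length-map inverse (elements nonRoot)) (length-elements nonRoot)))

  -- A fixed vertex is alone on its cycle and therefore its root.
  nonRoot⇒moved : ∀ v → nonRoot v ≡ true → moved α v ≡ true
  nonRoot⇒moved v nr = true-not (σ α v ≟ v) λ fixed →
    not-true (root v ≟ v) nr (stays fixed (~-sym (root~ v)))
    where
    iterate-fixed : σ α v ≡ v → ∀ i → iterate (σ α) i v ≡ v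
    iterate-fixed fixed zero    = refl
    iterate-fixed fixed (suc i) = trans (cong (σ α) (iterate-fixed fixed i)) fixed
    stays : ∀ {w} → σ α v ≡ v → v ~ w → w ≡ v
    stays fixed (i , refl) = iterate-fixed fixed i

  moved-σ : ∀ v → moved α v ≡ true → moved α (σ α v) ≡ true
  moved-σ v mv = true-not (σ α (σ α v) ≟ σ α v) λ eq → not-true (σ α v ≟ v) mv (proj₁ (bij α) eq)

-- Outside the common set D of non-roots there is one vertex x per cycle.  The path from α x back to x
-- lies in D up to its end, so it is also a path of β; the β-preimage of α x is not in D, hence is x.
determined : {G : Graph n} (α β : Aut G) → (∀ v → nonRoots α v ≡ nonRoots β v) →
  (∀ v → nonRoots α v ≡ true → σ α v ≡ σ β v) → ∀ v → σ α v ≡ σ β v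
determined {n} α β same agree x with nonRoots α x in x∉D
... | true  = agree x x∉D
... | false = ≡-sym (trans (cong (σ β) (≡-sym z≡x)) βz≡y)
  where
  module Oα = Orbits (σ α) (proj₁ (bij α))
  module Oβ = Orbits (σ β) (proj₁ (bij β))
  y = σ α x
  transfer : ∀ j w → iterate (σ α) j w ≡ x → w Oβ.~ x
  transfer zero    w refl = Oβ.~-refl w
  transfer (suc j) w eq with nonRoots α w in w∉D
  ... | false = subst (Oβ._~ x) (≡-sym (Oα.root-unique (suc j , eq) w∉D x∉D)) (Oβ.~-refl x)
  ... | true  = Oβ.~-trans {w} (1 , ≡-sym (agree w w∉D)) (transfer j (σ α w) (trans (≡-sym (shift j w)) eq))
    where
    shift : ∀ j w → iterate (σ α) (suc j) w ≡ iterate (σ α) j (σ α w)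
    shift zero    w = refl
    shift (suc j) w = cong (σ α) (shift j w)
  z : Fin n
  z = proj₁ (proj₂ (bij β) y)
  βz≡y : σ β z ≡ y
  βz≡y = proj₂ (proj₂ (bij β) y) refl
  z∉D : nonRoots β z ≡ false
  -- If `z` were in `D`, then `α` would send both `z` and `x` to `y`, so `z` would be `x`, which is
  -- not in `D`.
  z∉D with nonRoots α z in z∈D
  ... | false = trans (≡-sym (same z)) z∈D
  ... | true  with trans (≡-sym x∉D) (trans (cong (nonRoots α) (≡-sym (proj₁ (bij α) (trans (agree z z∈D) βz≡y)))) z∈D)
  ...   | ()
  y~x : y Oβ.~ x
  y~x with Oα.~-sym {x} {y} (1 , refl)
  ... | j , eq = transfer j y eq
  z≡x : z ≡ x
  z≡x = Oβ.root-unique (Oβ.~-trans {z} (1 , βz≡y) y~x) z∉D (trans (≡-sym (same x)) x∉D)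

-- Encoding of automorphisms

enumerate : (Fin n → Bool) → Fin n → (s : ℕ) → Fin s → Fin n
enumerate p z s i = nth z (elements p) (toℕ i)

enumerate-covers : (p : Fin n → Bool) (z : Fin n) {s : ℕ} → countF p ≤ s → ∀ v → p v ≡ true → ∃ λ i → enumerate p z s i ≡ v
enumerate-covers p z {s} p≤s v pv with ∈-nth z (∈-elements p v pv)
... | i , i< , eq = fromℕ< i<s , trans (cong (nth z (elements p)) (toℕ-fromℕ< i<s)) eq
  where
  i<s : i < s
  i<s = <-≤-trans i< (≤-trans (≤-reflexive (length-elements p)) p≤s)

funToFin-injective : (f g : Fin m → Fin n) → funToFin f ≡ funToFin g → ∀ i → f i ≡ g i
funToFin-injective f g eq i = trans (≡-sym (finToFun-funToFin f i))
  (trans (cong (λ c → finToFun c i) eq) (finToFun-funToFin g i))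

bit : Bool → Fin 2
bit false = zero
bit true  = suc zero

bit-injective : ∀ x y → bit x ≡ bit y → x ≡ y
bit-injective false false _ = refl
bit-injective true  true  _ = refl

-- `q` is kept apart from `s` because it must be positive, even when `S` is empty, to provide the
-- default index `zq`.
module Encoding {G : Graph n} (z : Fin n) (f : Fin m → Aut G)
  (distinct : ∀ i j → i ≢ j → ∃ λ v → σ (f i) v ≢ σ (f j) v)
  (ℓ s q : ℕ) (s≤q : s ≤ q) (zq : Fin q)
  (few : ∀ i → countF (nonRoots (f i)) ≤ ℓ)
  (S : Fin n → Bool) (moved⊆S : ∀ i v → moved (f i) v ≡ true → S v ≡ true) (S≤s : countF S ≤ s) where

  index : Fin n → Fin q
  index v with any? (λ j → enumerate S z q j ≟ v)
  ... | yes (j , _) = j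
  ... | no _        = zq

  enumerate-index : ∀ v → S v ≡ true → enumerate S z q (index v) ≡ v
  enumerate-index v Sv with any? (λ j → enumerate S z q j ≟ v)
  ... | yes (_ , eq) = eq
  ... | no none      = contradiction (enumerate-covers S z (≤-trans S≤s s≤q) v Sv) none

  -- Non-roots are moved, so they lie in `S`, and a 0-1 vector along `S` records them all.
  shape : Fin m → Fin s → Fin 2
  shape i j = bit (nonRoots (f i) (enumerate S z s j))

  -- Slots past the last non-root hold the index of the image of `z` and are not decoded.
  images : Fin m → Fin ℓ → Fin q
  images i j = index (σ (f i) (enumerate (nonRoots (f i)) z ℓ j))

  code : Fin m → Fin (2 ^ s * q ^ ℓ)
  code i = combine (funToFin (shape i)) (funToFin (images i))

  -- Equal shapes give equal sets of non-roots, hence equal enumerations of them. Equal images then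
  -- give agreement on this set, and `determined` extends it to all vertices.
  code-injective : Injective _≡_ _≡_ code
  code-injective {i} {j} eq with i ≟ j | combine-injective _ _ _ _ eq
  ... | yes i≡j | _ = i≡j
  ... | no i≢j  | shape≡ , images≡ with distinct i j i≢j
  ...   | v , σ≢ = contradiction (determined (f i) (f j) same agree v) σ≢
    where
    nonRoot∈S : ∀ i v → nonRoots (f i) v ≡ true → S v ≡ true
    nonRoot∈S i v nr = moved⊆S i v (nonRoot⇒moved (f i) v nr)
    image∈S : ∀ i v → nonRoots (f i) v ≡ true → S (σ (f i) v) ≡ true
    image∈S i v nr = moved⊆S i _ (moved-σ (f i) v (nonRoot⇒moved (f i) v nr))
    on-S : ∀ v → S v ≡ true → nonRoots (f i) v ≡ nonRoots (f j) v
    on-S v Sv with enumerate-covers S z S≤s v Sv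
    ... | l , refl = bit-injective _ _ (funToFin-injective (shape i) (shape j) shape≡ l)
    same : ∀ v → nonRoots (f i) v ≡ nonRoots (f j) v
    same v with nonRoots (f i) v in eqi | nonRoots (f j) v in eqj
    ... | true  | true  = refl
    ... | false | false = refl
    ... | true  | false = trans (≡-sym eqi) (trans (on-S v (nonRoot∈S i v eqi)) eqj)
    ... | false | true  = trans (≡-sym eqi) (trans (on-S v (nonRoot∈S j v eqj)) eqj)
    agree : ∀ v → nonRoots (f i) v ≡ true → σ (f i) v ≡ σ (f j) v
    agree v nr with enumerate-covers (nonRoots (f i)) z (few i) v nr
    ... | l , refl = begin
      σ (f i) v                                ≡⟨ enumerate-index _ (image∈S i v nr) ⟨
      enumerate S z q (index (σ (f i) v))      ≡⟨ cong (enumerate S z q) (funToFin-injective (images i) (images j) images≡ l) ⟩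
      enumerate S z q (index (σ (f j) v′))     ≡⟨ cong (λ xs → enumerate S z q (index (σ (f j) (nth z xs (toℕ l))))) (elements-cong _ _ same) ⟨
      enumerate S z q (index (σ (f j) v))      ≡⟨ enumerate-index _ (image∈S j v (trans (≡-sym (same v)) nr)) ⟩
      σ (f j) v                                ∎
      where
      open ≡-Reasoning
      v′ = enumerate (nonRoots (f j)) z ℓ l

  family-bound : m ≤ 2 ^ s * q ^ ℓ
  family-bound = injective⇒≤ code-injective

-- The final count

^-distribʳ-* : ∀ a b n → a ^ n * b ^ n ≡ (a * b) ^ n
^-distribʳ-* a b zero    = refl
^-distribʳ-* a b (suc n) =
  trans ([m*n]*[o*p]≡[m*o]*[n*p] a (a ^ n) b (b ^ n)) (cong (a * b *_) (^-distribʳ-* a b n))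

code-count : ∀ ℓ → 2 ^ (4 * ℓ) * (4 * (ℓ + 1)) ^ ℓ ≡ (64 * (ℓ + 1)) ^ ℓ
code-count ℓ = begin
  2 ^ (4 * ℓ) * (4 * (ℓ + 1)) ^ ℓ  ≡⟨ cong (_* (4 * (ℓ + 1)) ^ ℓ) (^-*-assoc 2 4 ℓ) ⟨
  16 ^ ℓ * (4 * (ℓ + 1)) ^ ℓ       ≡⟨ ^-distribʳ-* 16 (4 * (ℓ + 1)) ℓ ⟩
  (16 * (4 * (ℓ + 1))) ^ ℓ         ≡⟨ cong (_^ ℓ) (*-assoc 16 4 (ℓ + 1)) ⟨
  (64 * (ℓ + 1)) ^ ℓ               ∎
  where open ≡-Reasoning

-- Without vertices all conditions are vacuous for every `k`, so the hypothesis on twin-width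
-- excludes this case.
empty-contraction : (G : Graph 0) {k : ℕ} → ContractionSeq G k
empty-contraction G = record
  { P = λ _ () ; surj = λ _ () ; discrete = λ {} ; merge = λ _ () ; width< = λ _ () }

theorem3p10 : ∃ λ (C : ℕ) → 0 < C ×
    (∀ (ℓ d k n : ℕ) (G : Graph n) →
    MaxDegLE G d → TwwGE G k → 4 * d < k → d * d < k →
    (∀ (m : ℕ) (H : Graph m) → MaxDegLE H d → m < n ∸ ℓ → TwwLT H k) →
    AutCardLE G ((C * (ℓ + 1)) ^ ℓ))
-- `64 = 16 * 4`: the sets of non-roots contribute `2 ^ (4 * ℓ)`, that is `16 ^ ℓ`, and the images
-- `(4 * (ℓ + 1)) ^ ℓ`.
theorem3p10 = 64 , s≤s z≤n , bound
  where
  bound : ∀ (ℓ d k n : ℕ) (G : Graph n) →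
    MaxDegLE G d → TwwGE G k → 4 * d < k → d * d < k →
    (∀ (m : ℕ) (H : Graph m) → MaxDegLE H d → m < n ∸ ℓ → TwwLT H k) →
    AutCardLE G ((64 * (ℓ + 1)) ^ ℓ)
  bound ℓ d k zero    G _   tww≥k _    _    _     = contradiction (empty-contraction G) tww≥k
  bound ℓ d k (suc n) G deg tww≥k 4d<k d²<k small m f distinct =
    ≤-trans (Encoding.family-bound zero f distinct ℓ (4 * ℓ) (4 * (ℓ + 1)) (*-monoʳ-≤ 4 (m≤m+n ℓ 1))
               (fromℕ< {0} (≤-trans (m≤n+m 1 ℓ) (m≤m+n (ℓ + 1) _)))
               (few ∘ f) S (λ i v mv → true-anyF _ i mv) S≤4ℓ)
            (≤-reflexive (code-count ℓ))
    where
    few : ∀ (α : Aut G) → countF (nonRoots α) ≤ ℓ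
    few α = nonRoot-bound α deg 4d<k tww≥k d²<k small
    S : Fin (suc n) → Bool
    S v = anyF λ i → moved (f i) v
    S≤4ℓ : countF S ≤ 4 * ℓ
    S≤4ℓ = ≤-trans
      (support-bound (tabulate f) S
        (λ v Sv → let i , mv = anyF-true _ Sv in f i , ∈-tabulate⁺ {f = f} i , mv)
        (2 * ℓ) (λ α → ≤-trans (moved-bound α)
          (+-mono-≤ (few α) (≤-trans (few α) (≤-reflexive (≡-sym (+-identityʳ ℓ)))))))
      (≤-reflexive (≡-sym (*-assoc 2 2 ℓ)))
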